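{- Let $H$ be a set of hypotheses over $\mathcal T(\Sigma)$ and let $e,f\in\mathcal T(\Sigma)$. If $e\equiv^H f$, then $[\![e]\!]{\downarrow^H}=[\![f]\!]{\downarrow^H}$.
   Context: Fix a (possibly infinite) alphabet $\Sigma$. Pomsets. A labelled poset over $\Sigma$ is a triple $(S,\le,\lambda)$ with $S$ a finite set, $\le$ a partial order on $S$, $\lambda:S\to\Sigma$. A pomset is an isomorphism class of labelled posets (isomorphisms: bijections preserving labels and preserving and reflecting order); $\mathrm{Pom}$ is the set of pomsets, $1$ is the empty pomset, a letter is identified with the one-point pomset it labels. $U\parallel V$ is the disjoint union of $U$ and $V$ with no order between them; $U\cdot V$ is the disjoint union with in addition every point of $U$ below every point of $V$. $\mathrm{SP}$ (series-parallel pomsets) is the smallest set of pomsets containing $1$ and all letters and closed under $\cdot$ and $\parallel$. A series-parallel context $C\in\mathrm{PC}^{sp}$ is a series-parallel pomset over $\Sigma\cup\{*\}$ ($*\notin\Sigma$) with exactly one point labelled $*$; $C[U]$ is obtained by replacing that point by $U$ (points of $U$ keep their mutual order and inherit the order relations of the $*$-point with the other points). $C[L]=\{C[U]:U\in L\}$. Terms and semantics. $\mathcal T=\mathcal T(\Sigma)$ is generated by $e,f::=0\mid1\mid a\in\Sigma\mid e+f\mid e\cdot f\mid e\parallel f\mid e^*$. $[\![-]\!]:\mathcal T\to2^{\mathrm{SP}}$ is given by $[\![0]\!]=\emptyset$, $[\![1]\!]=\{1\}$, $[\![a]\!]=\{a\}$, $[\![e+f]\!]=[\![e]\!]\cup[\![f]\!]$,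 $[\![e\cdot f]\!]=[\![e]\!]\cdot[\![f]\!]$, $[\![e\parallel f]\!]=[\![e]\!]\parallel[\![f]\!]$ (pointwise), $[\![e^*]\!]=\bigcup_{n}[\![e]\!]^n$. Axioms. A hypothesis is an inequation $e\le f$ with $e,f\in\mathcal T$. For a set $H$ of hypotheses, $\equiv^H$ is the smallest congruence on $\mathcal T$ (w.r.t. all operators) such that, writing $e\leqq^H f$ for $e+f\equiv^H f$: $e\leqq^H f$ for every $e\le f\in H$, and for all $e,f,g$ (writing $\equiv,\leqq$ for $\equiv^H,\leqq^H$): $e+0\equiv e$; $e+e\equiv e$; $e+f\equiv f+e$; $e+(f+g)\equiv(e+f)+g$; $e(fg)\equiv(ef)g$; $e(f+g)\equiv ef+eg$; $(e+f)g\equiv eg+fg$; $e1\equiv e\equiv1e$; $e0\equiv0\equiv0e$; $e\parallel f\equiv f\parallel e$; $e\parallel1\equiv e$; $e\parallel0\equiv0$; $e\parallel(f\parallel g)\equiv(e\parallel f)\parallel g$; $e\parallel(f+g)\equiv e\parallel f+e\parallel g$; $1+ee^*\equiv e^*\equiv1+e^*e$; $e+fg\leqq g\Rightarrow f^*e\leqq g$; $e+fg\leqq f\Rightarrow eg^*\leqq f$. Closure. For $L\subseteq\mathrm{Pom}$, $L{\downarrow^H}$ is the smallest language containing $L$ such that for all $e\le f\in H$ and $C\in\mathrm{PC}^{sp}$: if $C[[\![f]\!]]\subseteq L{\downarrow^H}$ then $C[[\![e]\!]]\subseteq L{\downarrow^H}$. -}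

module Defs where

open import Level using (Level; Lift; lift; lower; _⊔_; 0ℓ) renaming (suc to lsuc)
open import Data.Bool.Base using (Bool; true; false; T)
open import Data.Bool.Properties using (T-irrelevant)
open import Data.Empty using (⊥)
import Data.Empty.Polymorphic as Poly
open import Data.Fin.Base using (Fin; zero; suc)
open import Data.Fin.Properties using (0↔⊥; 1↔⊤; +↔⊎)
open import Data.Maybe using (Maybe; nothing; is-just; to-witness-T)
open import Data.Nat.Base using (ℕ; zero; suc; _+_)
open import Data.Product.Base using (Σ; Σ-syntax; ∃-syntax; _×_; _,_; proj₁)
open import Data.Sum.Base using (_⊎_; inj₁; inj₂; [_,_]′)
open import Data.Sum.Function.Propositional using (_⊎-↔_)
open import Data.Sum.Relation.Binary.LeftOrder using (_⊎-<_; ⊎-<-isPartialOrder)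
open import Data.Sum.Relation.Binary.Pointwise
  using (Pointwise; ⊎-isPartialOrder; Pointwise-≡⇒≡; ≡⇒Pointwise-≡)
open import Data.Unit.Base using (⊤; tt)
open import Function.Base using (_∘_; id)
open import Function.Bundles using (_↔_; _⇔_; mk↔ₛ′; Inverse)
open import Function.Construct.Composition using (_↔-∘_; _⇔-∘_)
open import Function.Construct.Identity using (↔-id; ⇔-id)
open import Function.Construct.Symmetry using (↔-sym; ⇔-sym)
open import Relation.Binary.Core using (Rel)
open import Relation.Binary.Definitions using (Reflexive; Symmetric; Transitive; Antisymmetric)
open import Relation.Binary.PropositionalEquality
  using (_≡_; _≢_; refl; sym; trans; cong; subst; subst₂; isEquivalence)
import Relation.Binary.PropositionalEquality.Properties as ≡
open import Relation.Binary.Structures using (IsPartialOrder)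
open import Relation.Nullary.Negation using (contradiction)
open import Relation.Unary using (Pred; _⊆_; _≐_)

private
  variable
    a h ℓ ℓ₁ ℓ₂ : Level

Finite : Set → Set
Finite S = ∃[ n ] (S ↔ Fin n)

finite-⊥ : Finite ⊥
finite-⊥ = 0 , ↔-sym 0↔⊥

finite-⊤ : Finite ⊤
finite-⊤ = 1 , ↔-sym 1↔⊤

finite-⊎ : {S S′ : Set} → Finite S → Finite S′ → Finite (S ⊎ S′)
finite-⊎ (m , i) (n , j) = m + n , (↔-sym +↔⊎ ↔-∘ (i ⊎-↔ j))

finite-↔ : {S S′ : Set} → S ↔ S′ → Finite S′ → Finite S
finite-↔ i (n , j) = n , (j ↔-∘ i)

subset-≡ : {S : Set} (b : S → Bool) {x y : Σ S (T ∘ b)} → proj₁ x ≡ proj₁ y → x ≡ y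
subset-≡ b {s , p} {.s , q} refl = cong (s ,_) (T-irrelevant p q)

finite-T : ∀ b → Finite (T b)
finite-T false = finite-⊥
finite-T true  = finite-⊤

finite-FinSubset : ∀ n (b : Fin n → Bool) → Finite (Σ (Fin n) (T ∘ b))
finite-FinSubset zero    b = 0 , mk↔ₛ′ proj₁ (λ ()) (λ ()) (λ { (() , _) })
finite-FinSubset (suc n) b = finite-↔ split
  (finite-⊎ (finite-T (b zero)) (finite-FinSubset n (b ∘ suc)))
  where
  split : Σ (Fin (suc n)) (T ∘ b) ↔ (T (b zero) ⊎ Σ (Fin n) (T ∘ b ∘ suc))
  split = mk↔ₛ′
    (λ { (zero , p) → inj₁ p ; (suc i , p) → inj₂ (i , p) })
    (λ { (inj₁ p) → zero , p ; (inj₂ (i , p)) → suc i , p })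
    (λ { (inj₁ _) → refl ; (inj₂ _) → refl })
    (λ { (zero , _) → refl ; (suc _ , _) → refl })

finite-subset : {S : Set} (b : S → Bool) → Finite S → Finite (Σ S (T ∘ b))
finite-subset {S} b (n , i) = finite-↔ restrict (finite-FinSubset n (b ∘ from))
  where
  open Inverse i
  restrict : Σ S (T ∘ b) ↔ Σ (Fin n) (T ∘ b ∘ from)
  restrict = mk↔ₛ′
    (λ { (s , p) → to s , subst (T ∘ b) (sym (strictlyInverseʳ s)) p })
    (λ { (k , p) → from k , p })
    (λ { (k , _) → subset-≡ (b ∘ from) (strictlyInverseˡ k) })
    (λ { (s , _) → subset-≡ b (strictlyInverseʳ s) })

record LPoset (A : Set a) : Set (lsuc 0ℓ ⊔ a) where
  field
    Point          : Set
    finite         : Finite Point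
    _≤_            : Rel Point 0ℓ
    isPartialOrder : IsPartialOrder _≡_ _≤_
    label          : Point → A

open LPoset

-- There are no quotients: a pomset is represented by any of its labelled
-- posets, and _≅_ is equality of pomsets.

record _≅_ {A : Set a} (U V : LPoset A) : Set a where
  field
    bijection : Point U ↔ Point V
  open Inverse bijection public using (to; from)
  field
    label-≡ : ∀ x → label V (to x) ≡ label U x
    ≤-⇔     : ∀ x y → _≤_ U x y ⇔ _≤_ V (to x) (to y)

infix 4 _≅_

module _ {A : Set a} where

  ≅-refl : Reflexive (_≅_ {A = A})
  ≅-refl = record
    { bijection = ↔-id _ ; label-≡ = λ _ → refl ; ≤-⇔ = λ _ _ → ⇔-id _ }

  ≅-sym : Symmetric (_≅_ {A = A})
  ≅-sym {U} {V} i = record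
    { bijection = ↔-sym bijection
    ; label-≡   = λ y → trans (sym (label-≡ (from y))) (cong (label V) (inv y))
    ; ≤-⇔       = λ x y → ⇔-sym
        (subst₂ (λ x′ y′ → _≤_ U (from x) (from y) ⇔ _≤_ V x′ y′)
                (inv x) (inv y) (≤-⇔ (from x) (from y)))
    }
    where
    open _≅_ i
    inv : ∀ y → to (from y) ≡ y
    inv = Inverse.strictlyInverseˡ bijection

  ≅-trans : Transitive (_≅_ {A = A})
  ≅-trans i j = record
    { bijection = J.bijection ↔-∘ I.bijection
    ; label-≡   = λ x → trans (J.label-≡ (I.to x)) (I.label-≡ x)
    ; ≤-⇔       = λ x y → J.≤-⇔ (I.to x) (I.to y) ⇔-∘ I.≤-⇔ x y
    }
    where
    module I = _≅_ i
    module J = _≅_ j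

Pointwise⇒≡-isPartialOrder : {S S′ : Set} {R : Rel (S ⊎ S′) 0ℓ} →
  IsPartialOrder (Pointwise _≡_ _≡_) R → IsPartialOrder _≡_ R
Pointwise⇒≡-isPartialOrder po = record
  { isPreorder = record
    { isEquivalence = isEquivalence
    ; reflexive     = IsPartialOrder.reflexive po ∘ ≡⇒Pointwise-≡
    ; trans         = IsPartialOrder.trans po
    }
  ; antisym = λ p q → Pointwise-≡⇒≡ (IsPartialOrder.antisym po p q)
  }

module _ {A : Set a} where

  infixr 7 _·ᴾ_
  infixr 6 _∥ᴾ_

  1ᴾ : LPoset A
  1ᴾ = record
    { Point = ⊥ ; finite = finite-⊥ ; _≤_ = _≡_
    ; isPartialOrder = ≡.isPartialOrder ; label = λ () }

  letterᴾ : A → LPoset A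
  letterᴾ x = record
    { Point = ⊤ ; finite = finite-⊤ ; _≤_ = _≡_
    ; isPartialOrder = ≡.isPartialOrder ; label = λ _ → x }

  _·ᴾ_ : LPoset A → LPoset A → LPoset A
  U ·ᴾ V = record
    { Point  = Point U ⊎ Point V
    ; finite = finite-⊎ (finite U) (finite V)
    ; _≤_    = _≤_ U ⊎-< _≤_ V
    ; isPartialOrder = Pointwise⇒≡-isPartialOrder
        (⊎-<-isPartialOrder (isPartialOrder U) (isPartialOrder V))
    ; label  = [ label U , label V ]′
    }

  _∥ᴾ_ : LPoset A → LPoset A → LPoset A
  U ∥ᴾ V = record
    { Point  = Point U ⊎ Point V
    ; finite = finite-⊎ (finite U) (finite V)
    ; _≤_    = Pointwise (_≤_ U) (_≤_ V)
    ; isPartialOrder = Pointwise⇒≡-isPartialOrder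
        (⊎-isPartialOrder (isPartialOrder U) (isPartialOrder V))
    ; label  = [ label U , label V ]′
    }

  data SP : LPoset A → Set (lsuc 0ℓ ⊔ a) where
    sp-1      : SP 1ᴾ
    sp-letter : ∀ x → SP (letterᴾ x)
    sp-·      : ∀ {U V} → SP U → SP V → SP (U ·ᴾ V)
    sp-∥      : ∀ {U V} → SP U → SP V → SP (U ∥ᴾ V)
    sp-≅      : ∀ {U V} → U ≅ V → SP U → SP V

-- The extra letter * is nothing.
record Context (A : Set a) : Set (lsuc 0ℓ ⊔ a) where
  field
    poset       : LPoset (Maybe A)
    sp          : SP poset
    hole        : Point poset
    hole-label  : label poset hole ≡ nothing
    hole-unique : ∀ s → label poset s ≡ nothing → s ≡ hole

module Plug {A : Set a} (C : Context A) (U : LPoset A) where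
  open Context C
  private
    module C = LPoset poset
    module U = LPoset U
    module ≤C = IsPartialOrder C.isPartialOrder
    module ≤U = IsPartialOrder U.isPartialOrder

  -- The points of C not labelled *.  The condition is phrased with T because
  -- T has at most one proof, so that each such point occurs once.
  Outer : Set
  Outer = Σ[ s ∈ C.Point ] T (is-just (C.label s))

  PlugPoint : Set
  PlugPoint = Outer ⊎ U.Point

  _⊑_ : Rel PlugPoint 0ℓ
  inj₁ (s , _) ⊑ inj₁ (t , _) = s C.≤ t
  inj₁ (s , _) ⊑ inj₂ _       = s C.≤ hole
  inj₂ _       ⊑ inj₁ (t , _) = hole C.≤ t
  inj₂ u       ⊑ inj₂ v       = u U.≤ v

  hole-not-outer : ∀ {s} → T (is-just (C.label s)) → s ≢ hole
  hole-not-outer p refl = subst (T ∘ is-just) hole-label p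

  ⊑-refl : Reflexive _⊑_
  ⊑-refl {inj₁ _} = ≤C.refl
  ⊑-refl {inj₂ _} = ≤U.refl

  ⊑-trans : Transitive _⊑_
  ⊑-trans {inj₁ _} {inj₁ _} {inj₁ _} p q = ≤C.trans p q
  ⊑-trans {inj₁ _} {inj₁ _} {inj₂ _} p q = ≤C.trans p q
  ⊑-trans {inj₁ _} {inj₂ _} {inj₁ _} p q = ≤C.trans p q
  ⊑-trans {inj₁ _} {inj₂ _} {inj₂ _} p q = p
  ⊑-trans {inj₂ _} {inj₁ _} {inj₁ _} p q = ≤C.trans p q
  ⊑-trans {inj₂ _} {inj₁ (_ , t)} {inj₂ _} p q =
    contradiction (≤C.antisym q p) (hole-not-outer t)
  ⊑-trans {inj₂ _} {inj₂ _} {inj₁ _} p q = q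
  ⊑-trans {inj₂ _} {inj₂ _} {inj₂ _} p q = ≤U.trans p q

  ⊑-antisym : Antisymmetric _≡_ _⊑_
  ⊑-antisym {inj₁ _} {inj₁ _} p q =
    cong inj₁ (subset-≡ (is-just ∘ C.label) (≤C.antisym p q))
  ⊑-antisym {inj₁ (_ , t)} {inj₂ _} p q = contradiction (≤C.antisym p q) (hole-not-outer t)
  ⊑-antisym {inj₂ _} {inj₁ (_ , t)} p q = contradiction (≤C.antisym q p) (hole-not-outer t)
  ⊑-antisym {inj₂ _} {inj₂ _} p q = cong inj₂ (≤U.antisym p q)

  plug : LPoset A
  plug = record
    { Point  = PlugPoint
    ; finite = finite-⊎ (finite-subset (is-just ∘ C.label) C.finite) U.finite
    ; _≤_    = _⊑_
    ; isPartialOrder = record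
      { isPreorder = record
        { isEquivalence = isEquivalence
        ; reflexive     = λ { {x} refl → ⊑-refl {x} }
        ; trans         = λ {x} {y} {z} → ⊑-trans {x} {y} {z}
        }
      ; antisym = ⊑-antisym
      }
    ; label  = [ (λ { (s , t) → to-witness-T (C.label s) t }) , U.label ]′
    }

open Plug public using (plug)

-- A set of pomsets is a predicate on labelled posets invariant under _≅_.
record Language (A : Set a) ℓ : Set (lsuc (0ℓ ⊔ ℓ) ⊔ a) where
  field
    Contains : Pred (LPoset A) ℓ
    resp-≅   : ∀ {U V} → U ≅ V → Contains U → Contains V

open Language public

infix 4 _∈_ _≈ᴸ_

_∈_ : {A : Set a} → LPoset A → Language A ℓ → Set ℓ
U ∈ L = Contains L U

_≈ᴸ_ : {A : Set a} → Language A ℓ₁ → Language A ℓ₂ → Set (lsuc 0ℓ ⊔ a ⊔ ℓ₁ ⊔ ℓ₂)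
L ≈ᴸ M = Contains L ≐ Contains M

∅ᴸ : {A : Set a} → Language A ℓ
∅ᴸ = record { Contains = λ _ → Poly.⊥ ; resp-≅ = λ _ () }

module _ {A : Set a} where

  infixl 8 _^ᴸ_
  infixr 7 _·ᴸ_
  infixr 6 _∥ᴸ_
  infixr 5 _∪ᴸ_

  ｛_｝ : LPoset A → Language A (lsuc 0ℓ ⊔ a)
  ｛ V ｝ = record
    { Contains = λ U → Lift (lsuc 0ℓ) (U ≅ V)
    ; resp-≅   = λ i j → lift (≅-trans (≅-sym i) (lower j))
    }

  _∪ᴸ_ : Language A ℓ₁ → Language A ℓ₂ → Language A (ℓ₁ ⊔ ℓ₂)
  L ∪ᴸ M = record
    { Contains = λ U → U ∈ L ⊎ U ∈ M
    ; resp-≅   = λ { i (inj₁ p) → inj₁ (resp-≅ L i p) ; i (inj₂ q) → inj₂ (resp-≅ M i q) }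
    }

  _·ᴸ_ : Language A ℓ₁ → Language A ℓ₂ → Language A (lsuc 0ℓ ⊔ a ⊔ ℓ₁ ⊔ ℓ₂)
  L ·ᴸ M = record
    { Contains = λ W → ∃[ U ] ∃[ V ] (U ∈ L × V ∈ M × W ≅ U ·ᴾ V)
    ; resp-≅   = λ { i (U , V , p , q , j) → U , V , p , q , ≅-trans (≅-sym i) j }
    }

  _∥ᴸ_ : Language A ℓ₁ → Language A ℓ₂ → Language A (lsuc 0ℓ ⊔ a ⊔ ℓ₁ ⊔ ℓ₂)
  L ∥ᴸ M = record
    { Contains = λ W → ∃[ U ] ∃[ V ] (U ∈ L × V ∈ M × W ≅ U ∥ᴾ V)
    ; resp-≅   = λ { i (U , V , p , q , j) → U , V , p , q , ≅-trans (≅-sym i) j }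
    }

  _^ᴸ_ : Language A (lsuc 0ℓ ⊔ a) → ℕ → Language A (lsuc 0ℓ ⊔ a)
  L ^ᴸ zero  = ｛ 1ᴾ ｝
  L ^ᴸ suc n = L ·ᴸ L ^ᴸ n

  _*ᴸ : Language A (lsuc 0ℓ ⊔ a) → Language A (lsuc 0ℓ ⊔ a)
  L *ᴸ = record
    { Contains = λ U → ∃[ n ] U ∈ L ^ᴸ n
    ; resp-≅   = λ { i (n , p) → n , resp-≅ (L ^ᴸ n) i p }
    }

  _[_]ᴸ : Context A → Language A ℓ → Language A (lsuc 0ℓ ⊔ a ⊔ ℓ)
  C [ L ]ᴸ = record
    { Contains = λ W → ∃[ U ] (U ∈ L × W ≅ plug C U)
    ; resp-≅   = λ { i (U , p , j) → U , p , ≅-trans (≅-sym i) j }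
    }

infixl 9 _*
infixr 8 _·_
infixr 7 _∥_
infixr 6 _⊕_

data Term (A : Set a) : Set a where
  𝟎 𝟏         : Term A
  letter      : A → Term A
  _⊕_ _·_ _∥_ : Term A → Term A → Term A
  _*          : Term A → Term A

⟦_⟧ : {A : Set a} → Term A → Language A (lsuc 0ℓ ⊔ a)
⟦ 𝟎 ⟧        = ∅ᴸ
⟦ 𝟏 ⟧        = ｛ 1ᴾ ｝
⟦ letter x ⟧ = ｛ letterᴾ x ｝
⟦ e ⊕ f ⟧    = ⟦ e ⟧ ∪ᴸ ⟦ f ⟧
⟦ e · f ⟧    = ⟦ e ⟧ ·ᴸ ⟦ f ⟧
⟦ e ∥ f ⟧    = ⟦ e ⟧ ∥ᴸ ⟦ f ⟧
⟦ e * ⟧      = ⟦ e ⟧ *ᴸ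

⟦_⟧⊆SP : {A : Set a} (e : Term A) → Contains ⟦ e ⟧ ⊆ SP
⟦ 𝟏 ⟧⊆SP        (lift i)              = sp-≅ (≅-sym i) sp-1
⟦ letter x ⟧⊆SP (lift i)              = sp-≅ (≅-sym i) (sp-letter x)
⟦ e ⊕ f ⟧⊆SP    (inj₁ p)              = ⟦ e ⟧⊆SP p
⟦ e ⊕ f ⟧⊆SP    (inj₂ q)              = ⟦ f ⟧⊆SP q
⟦ e · f ⟧⊆SP    (_ , _ , p , q , i)   = sp-≅ (≅-sym i) (sp-· (⟦ e ⟧⊆SP p) (⟦ f ⟧⊆SP q))
⟦ e ∥ f ⟧⊆SP    (_ , _ , p , q , i)   = sp-≅ (≅-sym i) (sp-∥ (⟦ e ⟧⊆SP p) (⟦ f ⟧⊆SP q))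
⟦ e * ⟧⊆SP      (n , p)               = power n p
  where
  power : ∀ n → Contains (⟦ e ⟧ ^ᴸ n) ⊆ SP
  power zero    (lift i)            = sp-≅ (≅-sym i) sp-1
  power (suc n) (_ , _ , p , q , i) = sp-≅ (≅-sym i) (sp-· (⟦ e ⟧⊆SP p) (power n q))

-- H e f means that the inequation e ≤ f belongs to H.
Hypotheses : Set a → (h : Level) → Set (a ⊔ lsuc h)
Hypotheses A h = Rel (Term A) h

infix 4 _⊢_≡ᴴ_ _⊢_≦_

mutual

  _⊢_≦_ : {A : Set a} → Hypotheses A h → Rel (Term A) (a ⊔ h)
  H ⊢ e ≦ f = H ⊢ e ⊕ f ≡ᴴ f

  data _⊢_≡ᴴ_ {A : Set a} (H : Hypotheses A h) : Rel (Term A) (a ⊔ h) where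
    hyp      : ∀ {e f} → H e f → H ⊢ e ≦ f

    reflᴴ    : ∀ {e} → H ⊢ e ≡ᴴ e
    symᴴ     : ∀ {e f} → H ⊢ e ≡ᴴ f → H ⊢ f ≡ᴴ e
    transᴴ   : ∀ {e f g} → H ⊢ e ≡ᴴ f → H ⊢ f ≡ᴴ g → H ⊢ e ≡ᴴ g

    ⊕-cong   : ∀ {e e′ f f′} → H ⊢ e ≡ᴴ e′ → H ⊢ f ≡ᴴ f′ → H ⊢ e ⊕ f ≡ᴴ e′ ⊕ f′
    ·-cong   : ∀ {e e′ f f′} → H ⊢ e ≡ᴴ e′ → H ⊢ f ≡ᴴ f′ → H ⊢ e · f ≡ᴴ e′ · f′
    ∥-cong   : ∀ {e e′ f f′} → H ⊢ e ≡ᴴ e′ → H ⊢ f ≡ᴴ f′ → H ⊢ e ∥ f ≡ᴴ e′ ∥ f′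
    *-cong   : ∀ {e e′} → H ⊢ e ≡ᴴ e′ → H ⊢ e * ≡ᴴ e′ *

    ⊕-identʳ : ∀ e → H ⊢ e ⊕ 𝟎 ≡ᴴ e
    ⊕-idem   : ∀ e → H ⊢ e ⊕ e ≡ᴴ e
    ⊕-comm   : ∀ e f → H ⊢ e ⊕ f ≡ᴴ f ⊕ e
    ⊕-assoc  : ∀ e f g → H ⊢ e ⊕ (f ⊕ g) ≡ᴴ (e ⊕ f) ⊕ g

    ·-assoc  : ∀ e f g → H ⊢ e · (f · g) ≡ᴴ (e · f) · g
    ·-distˡ  : ∀ e f g → H ⊢ e · (f ⊕ g) ≡ᴴ (e · f) ⊕ (e · g)
    ·-distʳ  : ∀ e f g → H ⊢ (e ⊕ f) · g ≡ᴴ (e · g) ⊕ (f · g)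
    ·-identʳ : ∀ e → H ⊢ e · 𝟏 ≡ᴴ e
    ·-identˡ : ∀ e → H ⊢ e ≡ᴴ 𝟏 · e
    ·-zeroʳ  : ∀ e → H ⊢ e · 𝟎 ≡ᴴ 𝟎
    ·-zeroˡ  : ∀ e → H ⊢ 𝟎 ≡ᴴ 𝟎 · e

    ∥-comm   : ∀ e f → H ⊢ e ∥ f ≡ᴴ f ∥ e
    ∥-identʳ : ∀ e → H ⊢ e ∥ 𝟏 ≡ᴴ e
    ∥-zeroʳ  : ∀ e → H ⊢ e ∥ 𝟎 ≡ᴴ 𝟎
    ∥-assoc  : ∀ e f g → H ⊢ e ∥ (f ∥ g) ≡ᴴ (e ∥ f) ∥ g
    ∥-distˡ  : ∀ e f g → H ⊢ e ∥ (f ⊕ g) ≡ᴴ (e ∥ f) ⊕ (e ∥ g)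

    *-unfoldˡ : ∀ e → H ⊢ 𝟏 ⊕ (e · e *) ≡ᴴ e *
    *-unfoldʳ : ∀ e → H ⊢ e * ≡ᴴ 𝟏 ⊕ (e * · e)
    *-leastˡ  : ∀ {e f g} → H ⊢ e ⊕ (f · g) ≦ g → H ⊢ f * · e ≦ g
    *-leastʳ  : ∀ {e f g} → H ⊢ e ⊕ (f · g) ≦ f → H ⊢ e · g * ≦ f

module _ {A : Set a} where

  data Closure (H : Hypotheses A h) (L : Language A ℓ) :
               Pred (LPoset A) (lsuc 0ℓ ⊔ a ⊔ h ⊔ ℓ) where
    base : ∀ {U} → U ∈ L → Closure H L U
    step : ∀ {e f} → H e f → (C : Context A) →
           (∀ {V} → V ∈ C [ ⟦ f ⟧ ]ᴸ → Closure H L V) →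
           ∀ {U} → U ∈ C [ ⟦ e ⟧ ]ᴸ → Closure H L U

  infixl 8 _↓[_]

  _↓[_] : Language A ℓ → (H : Hypotheses A h) → Language A (lsuc 0ℓ ⊔ a ⊔ h ⊔ ℓ)
  L ↓[ H ] = record { Contains = Closure H L ; resp-≅ = resp }
    where
    resp : ∀ {U V} → U ≅ V → Closure H L U → Closure H L V
    resp i (base p)             = base (resp-≅ L i p)
    resp i (step {e} eH C k p) = step eH C k (resp-≅ (C [ ⟦ e ⟧ ]ᴸ) i p)

{-# OPTIONS --safe #-}
module Submission where

-- Write e ≲ f for ⟦ e ⟧ ⊆ ⟦ f ⟧ ↓[ H ]; every rule of ≡ᴴ is sound for mutual ≲.
-- The congruence and least-fixpoint rules rest on L↓ · V ⊆ (L · V)↓ for V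
-- series-parallel, and its analogues for V · L and L ∥ V: a closure step in a
-- context C remains one in the larger context C · V.  The fixed factor always
-- comes from a term's semantics, so it never has to be shown that closures stay
-- series-parallel.

open import Level using (Level; 0ℓ; lift)
open import Data.Empty using (⊥)
open import Data.Maybe.Base using (just; nothing)
open import Data.Nat.Base using (zero; suc)
open import Data.Product.Base using (Σ-syntax; _×_; _,_; proj₁; proj₂; swap)
open import Data.Sum.Base as Sum using (_⊎_; inj₁; inj₂; [_,_]; [_,_]′)
open import Data.Sum.Function.Propositional using (_⊎-↔_)
open import Data.Sum.Properties using (swap-↔)
open import Data.Sum.Relation.Binary.LeftOrder using (₁∼₂; ₁∼₁; ₂∼₂)
open import Data.Sum.Relation.Binary.Pointwise using (inj₁; inj₂)
open import Data.Unit.Base using (tt)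
open import Function.Base using (_∘_; id)
open import Function.Bundles using (_↔_; mk↔ₛ′; mk⇔; Inverse; Equivalence)
open import Function.Construct.Identity using (↔-id)
open import Function.Related.TypeIsomorphisms using (⊎-assoc)
open import Relation.Binary.PropositionalEquality using (_≡_; refl; cong; subst₂)
open import Relation.Unary using (_⊆_)
open import Defs

open LPoset
open Context

private
  variable
    a ℓ ℓ₁ ℓ₂ : Level
    A B : Set a

-- Isomorphisms: congruence and the monoid laws of the two products.

module _ {U V : LPoset A} where

  -- Reflection of the order is asked for as monotonicity of `from`, so that both directions can be
  -- given by cases on the points of their source; transport along `from (to x) ≡ x` then yields the
  -- form that `≤-⇔` demands.
  mk≅ : (i : Point U ↔ Point V) → let open Inverse i using (to; from) in
        (∀ x → label V (to x) ≡ label U x) →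
        (∀ {x y} → _≤_ U x y → _≤_ V (to x) (to y)) →
        (∀ {x y} → _≤_ V x y → _≤_ U (from x) (from y)) →
        U ≅ V
  mk≅ i lab mono cancel = record
    { bijection = i
    ; label-≡   = lab
    ; ≤-⇔       = λ x y → mk⇔ mono λ p →
        subst₂ (_≤_ U) (strictlyInverseʳ x) (strictlyInverseʳ y) (cancel p)
    }
    where open Inverse i using (strictlyInverseʳ)

  to-mono : (i : U ≅ V) → ∀ {x y} → _≤_ U x y → _≤_ V (_≅_.to i x) (_≅_.to i y)
  to-mono i = Equivalence.to (_≅_.≤-⇔ i _ _)

module _ {U U′ V V′ : LPoset A} (i : U ≅ U′) (j : V ≅ V′) where
  private
    module I = _≅_ i
    module J = _≅_ j

  ·ᴾ-cong : U ·ᴾ V ≅ U′ ·ᴾ V′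
  ·ᴾ-cong = mk≅ (I.bijection ⊎-↔ J.bijection) [ I.label-≡ , J.label-≡ ]
    (λ { ₁∼₂ → ₁∼₂ ; (₁∼₁ p) → ₁∼₁ (to-mono i p) ; (₂∼₂ p) → ₂∼₂ (to-mono j p) })
    (λ { ₁∼₂ → ₁∼₂ ; (₁∼₁ p) → ₁∼₁ (to-mono (≅-sym i) p) ; (₂∼₂ p) → ₂∼₂ (to-mono (≅-sym j) p) })

  ∥ᴾ-cong : U ∥ᴾ V ≅ U′ ∥ᴾ V′
  ∥ᴾ-cong = mk≅ (I.bijection ⊎-↔ J.bijection) [ I.label-≡ , J.label-≡ ]
    (λ { (inj₁ p) → inj₁ (to-mono i p) ; (inj₂ p) → inj₂ (to-mono j p) })
    (λ { (inj₁ p) → inj₁ (to-mono (≅-sym i) p) ; (inj₂ p) → inj₂ (to-mono (≅-sym j) p) })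

·ᴾ-congˡ : (U : LPoset A) {V V′ : LPoset A} → V ≅ V′ → U ·ᴾ V ≅ U ·ᴾ V′
·ᴾ-congˡ U = ·ᴾ-cong (≅-refl {x = U})

·ᴾ-congʳ : (V : LPoset A) {U U′ : LPoset A} → U ≅ U′ → U ·ᴾ V ≅ U′ ·ᴾ V
·ᴾ-congʳ V i = ·ᴾ-cong i (≅-refl {x = V})

∥ᴾ-congˡ : (U : LPoset A) {V V′ : LPoset A} → V ≅ V′ → U ∥ᴾ V ≅ U ∥ᴾ V′
∥ᴾ-congˡ U = ∥ᴾ-cong (≅-refl {x = U})

∥ᴾ-congʳ : (V : LPoset A) {U U′ : LPoset A} → U ≅ U′ → U ∥ᴾ V ≅ U′ ∥ᴾ V
∥ᴾ-congʳ V i = ∥ᴾ-cong i (≅-refl {x = V})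

⊎⊥↔ : (S : Set) → (S ⊎ ⊥) ↔ S
⊎⊥↔ S = mk↔ₛ′ [ id , (λ ()) ]′ inj₁ (λ _ → refl) [ (λ _ → refl) , (λ ()) ]

⊥⊎↔ : (S : Set) → (⊥ ⊎ S) ↔ S
⊥⊎↔ S = mk↔ₛ′ [ (λ ()) , id ]′ inj₂ (λ _ → refl) [ (λ ()) , (λ _ → refl) ]

·ᴾ-identityʳ : (U : LPoset A) → U ·ᴾ 1ᴾ ≅ U
·ᴾ-identityʳ U = mk≅ (⊎⊥↔ _) [ (λ _ → refl) , (λ ()) ]
  (λ { {inj₁ _} {inj₁ _} (₁∼₁ p) → p }) ₁∼₁

·ᴾ-identityˡ : (U : LPoset A) → 1ᴾ ·ᴾ U ≅ U
·ᴾ-identityˡ U = mk≅ (⊥⊎↔ _) [ (λ ()) , (λ _ → refl) ]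
  (λ { {inj₂ _} {inj₂ _} (₂∼₂ p) → p }) ₂∼₂

∥ᴾ-identityʳ : (U : LPoset A) → U ∥ᴾ 1ᴾ ≅ U
∥ᴾ-identityʳ U = mk≅ (⊎⊥↔ _) [ (λ _ → refl) , (λ ()) ]
  (λ { {inj₁ _} {inj₁ _} (inj₁ p) → p }) inj₁

∥ᴾ-comm : (U V : LPoset A) → U ∥ᴾ V ≅ V ∥ᴾ U
∥ᴾ-comm U V = mk≅ swap-↔ [ (λ _ → refl) , (λ _ → refl) ]
  (λ { (inj₁ p) → inj₂ p ; (inj₂ p) → inj₁ p })
  (λ { (inj₁ p) → inj₂ p ; (inj₂ p) → inj₁ p })

·ᴾ-assoc : (U V W : LPoset A) → (U ·ᴾ V) ·ᴾ W ≅ U ·ᴾ (V ·ᴾ W)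
·ᴾ-assoc U V W = mk≅ (⊎-assoc 0ℓ _ _ _) [ [ (λ _ → refl) , (λ _ → refl) ] , (λ _ → refl) ]
  (λ { (₁∼₁ ₁∼₂) → ₁∼₂ ; (₁∼₁ (₁∼₁ p)) → ₁∼₁ p ; (₁∼₁ (₂∼₂ p)) → ₂∼₂ (₁∼₁ p)
     ; {inj₁ (inj₁ _)} ₁∼₂ → ₁∼₂ ; {inj₁ (inj₂ _)} ₁∼₂ → ₂∼₂ ₁∼₂
     ; (₂∼₂ p) → ₂∼₂ (₂∼₂ p) })
  (λ { (₁∼₁ p) → ₁∼₁ (₁∼₁ p)
     ; {_} {inj₂ (inj₁ _)} ₁∼₂ → ₁∼₁ ₁∼₂ ; {_} {inj₂ (inj₂ _)} ₁∼₂ → ₁∼₂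
     ; (₂∼₂ ₁∼₂) → ₁∼₂ ; (₂∼₂ (₁∼₁ p)) → ₁∼₁ (₂∼₂ p) ; (₂∼₂ (₂∼₂ p)) → ₂∼₂ p })

∥ᴾ-assoc : (U V W : LPoset A) → (U ∥ᴾ V) ∥ᴾ W ≅ U ∥ᴾ (V ∥ᴾ W)
∥ᴾ-assoc U V W = mk≅ (⊎-assoc 0ℓ _ _ _) [ [ (λ _ → refl) , (λ _ → refl) ] , (λ _ → refl) ]
  (λ { (inj₁ (inj₁ p)) → inj₁ p ; (inj₁ (inj₂ p)) → inj₂ (inj₁ p) ; (inj₂ p) → inj₂ (inj₂ p) })
  (λ { (inj₁ p) → inj₁ (inj₁ p) ; (inj₂ (inj₁ p)) → inj₁ (inj₂ p) ; (inj₂ (inj₂ p)) → inj₂ p })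

-- Relabelling, and contexts enlarged by a fixed factor.

relabel : (A → B) → LPoset A → LPoset B
relabel g U = record
  { Point = Point U ; finite = finite U ; _≤_ = _≤_ U
  ; isPartialOrder = isPartialOrder U ; label = g ∘ label U }

relabel-≅ : (g : A → B) {U V : LPoset A} → U ≅ V → relabel g U ≅ relabel g V
relabel-≅ g i = record
  { bijection = bijection ; label-≡ = cong g ∘ label-≡ ; ≤-⇔ = ≤-⇔ }
  where open _≅_ i

-- In every case but `sp-≅`, relabelling before or after the construction gives the same points and
-- order and pointwise equal labels, so the identity bijection is an isomorphism.
relabel-SP : (g : A → B) {U : LPoset A} → SP U → SP (relabel g U)
relabel-SP g sp-1          = sp-≅ (mk≅ (↔-id _) (λ ()) id id) sp-1
relabel-SP g (sp-letter x) = sp-≅ (mk≅ (↔-id _) (λ _ → refl) id id) (sp-letter (g x))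
relabel-SP g (sp-· p q)    = sp-≅ (mk≅ (↔-id _) [ (λ _ → refl) , (λ _ → refl) ] id id)
                                  (sp-· (relabel-SP g p) (relabel-SP g q))
relabel-SP g (sp-∥ p q)    = sp-≅ (mk≅ (↔-id _) [ (λ _ → refl) , (λ _ → refl) ] id id)
                                  (sp-∥ (relabel-SP g p) (relabel-SP g q))
relabel-SP g (sp-≅ i p)    = sp-≅ (relabel-≅ g i) (relabel-SP g p)

∙ᶜ : Context A
∙ᶜ = record
  { poset = letterᴾ nothing ; sp = sp-letter nothing
  ; hole = tt ; hole-label = refl ; hole-unique = λ _ _ → refl }

plug-∙ᶜ : (U : LPoset A) → plug ∙ᶜ U ≅ U
plug-∙ᶜ U = mk≅
  (mk↔ₛ′ [ (λ ()) , id ]′ inj₂ (λ _ → refl) [ (λ ()) , (λ _ → refl) ])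
  [ (λ ()) , (λ _ → refl) ]
  (λ { {inj₂ _} {inj₂ _} p → p }) id

module _ (C : Context A) {V : LPoset A} (V∈SP : SP V) where
  private
    V∈SP′ = relabel-SP just V∈SP

  -- The superscript names the side on which `V` is added. Relabelling by `just` keeps the letter
  -- `nothing` out of `V`, so the hole of `C` remains the only one; `V∈SP` keeps the enlarged poset
  -- series-parallel.
  _·ᶜʳ_ : Context A
  _·ᶜʳ_ = record
    { poset       = poset C ·ᴾ relabel just V
    ; sp          = sp-· (sp C) V∈SP′
    ; hole        = inj₁ (hole C)
    ; hole-label  = hole-label C
    ; hole-unique = λ { (inj₁ s) p → cong inj₁ (hole-unique C s p) ; (inj₂ _) () }
    }

  _·ᶜˡ_ : Context A
  _·ᶜˡ_ = record
    { poset       = relabel just V ·ᴾ poset C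
    ; sp          = sp-· V∈SP′ (sp C)
    ; hole        = inj₂ (hole C)
    ; hole-label  = hole-label C
    ; hole-unique = λ { (inj₂ s) p → cong inj₂ (hole-unique C s p) ; (inj₁ _) () }
    }

  _∥ᶜ_ : Context A
  _∥ᶜ_ = record
    { poset       = poset C ∥ᴾ relabel just V
    ; sp          = sp-∥ (sp C) V∈SP′
    ; hole        = inj₁ (hole C)
    ; hole-label  = hole-label C
    ; hole-unique = λ { (inj₁ s) p → cong inj₁ (hole-unique C s p) ; (inj₂ _) () }
    }

  module _ (X : LPoset A) where
    private
      -- Points of `V` become outer points of the enlarged context, with trivial witness `tt`
      -- because their labels are `just`. The points of a plugged context depend on its points and
      -- labels but not on its order, so this bijection also serves `_∥ᶜ_`.
      left : Plug.PlugPoint _·ᶜʳ_ X ↔ (Plug.PlugPoint C X ⊎ Point V)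
      left = mk↔ₛ′
        (λ { (inj₁ (inj₁ s , t)) → inj₁ (inj₁ (s , t))
           ; (inj₁ (inj₂ v , _)) → inj₂ v
           ; (inj₂ x)            → inj₁ (inj₂ x) })
        (λ { (inj₁ (inj₁ (s , t))) → inj₁ (inj₁ s , t)
           ; (inj₁ (inj₂ x))       → inj₂ x
           ; (inj₂ v)              → inj₁ (inj₂ v , tt) })
        (λ { (inj₁ (inj₁ _)) → refl ; (inj₁ (inj₂ _)) → refl ; (inj₂ _) → refl })
        (λ { (inj₁ (inj₁ _ , _)) → refl ; (inj₁ (inj₂ _ , _)) → refl ; (inj₂ _) → refl })

      right : Plug.PlugPoint _·ᶜˡ_ X ↔ (Point V ⊎ Plug.PlugPoint C X)
      right = mk↔ₛ′
        (λ { (inj₁ (inj₂ s , t)) → inj₂ (inj₁ (s , t))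
           ; (inj₁ (inj₁ v , _)) → inj₁ v
           ; (inj₂ x)            → inj₂ (inj₂ x) })
        (λ { (inj₂ (inj₁ (s , t))) → inj₁ (inj₂ s , t)
           ; (inj₂ (inj₂ x))       → inj₂ x
           ; (inj₁ v)              → inj₁ (inj₁ v , tt) })
        (λ { (inj₂ (inj₁ _)) → refl ; (inj₂ (inj₂ _)) → refl ; (inj₁ _) → refl })
        (λ { (inj₁ (inj₁ _ , _)) → refl ; (inj₁ (inj₂ _ , _)) → refl ; (inj₂ _) → refl })

    -- Points of `X` take over the relations of the hole, which lies in the left summand and hence
    -- below all of `V`. Two points of `X` are compared in `X` itself, which is why that case
    -- carries no constructor on the plugged side.
    plug-·ᶜʳ : plug _·ᶜʳ_ X ≅ plug C X ·ᴾ V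
    plug-·ᶜʳ = mk≅ left
      (λ { (inj₁ (inj₁ _ , _)) → refl ; (inj₁ (inj₂ _ , _)) → refl ; (inj₂ _) → refl })
      (λ { {inj₁ (inj₁ _ , _)} {inj₁ (inj₁ _ , _)} (₁∼₁ p) → ₁∼₁ p
         ; {inj₁ (inj₁ _ , _)} {inj₁ (inj₂ _ , _)} ₁∼₂     → ₁∼₂
         ; {inj₁ (inj₂ _ , _)} {inj₁ (inj₂ _ , _)} (₂∼₂ p) → ₂∼₂ p
         ; {inj₁ (inj₁ _ , _)} {inj₂ _}            (₁∼₁ p) → ₁∼₁ p
         ; {inj₂ _}            {inj₁ (inj₁ _ , _)} (₁∼₁ p) → ₁∼₁ p
         ; {inj₂ _}            {inj₁ (inj₂ _ , _)} ₁∼₂     → ₁∼₂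
         ; {inj₂ _}            {inj₂ _}            p       → ₁∼₁ p })
      (λ { {inj₁ (inj₁ _)} {inj₁ (inj₁ _)} (₁∼₁ p) → ₁∼₁ p
         ; {inj₁ (inj₁ _)} {inj₁ (inj₂ _)} (₁∼₁ p) → ₁∼₁ p
         ; {inj₁ (inj₂ _)} {inj₁ (inj₁ _)} (₁∼₁ p) → ₁∼₁ p
         ; {inj₁ (inj₂ _)} {inj₁ (inj₂ _)} (₁∼₁ p) → p
         ; {inj₁ (inj₁ _)} {inj₂ _}        ₁∼₂     → ₁∼₂
         ; {inj₁ (inj₂ _)} {inj₂ _}        ₁∼₂     → ₁∼₂
         ; {inj₂ _}        {inj₂ _}        (₂∼₂ p) → ₂∼₂ p })

    plug-·ᶜˡ : plug _·ᶜˡ_ X ≅ V ·ᴾ plug C X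
    plug-·ᶜˡ = mk≅ right
      (λ { (inj₁ (inj₁ _ , _)) → refl ; (inj₁ (inj₂ _ , _)) → refl ; (inj₂ _) → refl })
      (λ { {inj₁ (inj₁ _ , _)} {inj₁ (inj₁ _ , _)} (₁∼₁ p) → ₁∼₁ p
         ; {inj₁ (inj₁ _ , _)} {inj₁ (inj₂ _ , _)} ₁∼₂     → ₁∼₂
         ; {inj₁ (inj₂ _ , _)} {inj₁ (inj₂ _ , _)} (₂∼₂ p) → ₂∼₂ p
         ; {inj₁ (inj₁ _ , _)} {inj₂ _}            ₁∼₂     → ₁∼₂
         ; {inj₁ (inj₂ _ , _)} {inj₂ _}            (₂∼₂ p) → ₂∼₂ p
         ; {inj₂ _}            {inj₁ (inj₂ _ , _)} (₂∼₂ p) → ₂∼₂ p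
         ; {inj₂ _}            {inj₂ _}            p       → ₂∼₂ p })
      (λ { {inj₂ (inj₁ _)} {inj₂ (inj₁ _)} (₂∼₂ p) → ₂∼₂ p
         ; {inj₂ (inj₁ _)} {inj₂ (inj₂ _)} (₂∼₂ p) → ₂∼₂ p
         ; {inj₂ (inj₂ _)} {inj₂ (inj₁ _)} (₂∼₂ p) → ₂∼₂ p
         ; {inj₂ (inj₂ _)} {inj₂ (inj₂ _)} (₂∼₂ p) → p
         ; {inj₁ _}        {inj₂ (inj₁ _)} ₁∼₂     → ₁∼₂
         ; {inj₁ _}        {inj₂ (inj₂ _)} ₁∼₂     → ₁∼₂
         ; {inj₁ _}        {inj₁ _}        (₁∼₁ p) → ₁∼₁ p })

    plug-∥ᶜ : plug _∥ᶜ_ X ≅ plug C X ∥ᴾ V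
    plug-∥ᶜ = mk≅ left
      (λ { (inj₁ (inj₁ _ , _)) → refl ; (inj₁ (inj₂ _ , _)) → refl ; (inj₂ _) → refl })
      (λ { {inj₁ (inj₁ _ , _)} {inj₁ (inj₁ _ , _)} (inj₁ p) → inj₁ p
         ; {inj₁ (inj₂ _ , _)} {inj₁ (inj₂ _ , _)} (inj₂ p) → inj₂ p
         ; {inj₁ (inj₁ _ , _)} {inj₂ _}            (inj₁ p) → inj₁ p
         ; {inj₂ _}            {inj₁ (inj₁ _ , _)} (inj₁ p) → inj₁ p
         ; {inj₂ _}            {inj₂ _}            p        → inj₁ p })
      (λ { {inj₁ (inj₁ _)} {inj₁ (inj₁ _)} (inj₁ p) → inj₁ p
         ; {inj₁ (inj₁ _)} {inj₁ (inj₂ _)} (inj₁ p) → inj₁ p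
         ; {inj₁ (inj₂ _)} {inj₁ (inj₁ _)} (inj₁ p) → inj₁ p
         ; {inj₁ (inj₂ _)} {inj₁ (inj₂ _)} (inj₁ p) → p
         ; {inj₂ _}        {inj₂ _}        (inj₂ p) → inj₂ p })

-- Transporting closure derivations.

module _ {a h} {A : Set a} (H : Hypotheses A h) where

  resp : (L : Language A ℓ) {U V : LPoset A} → U ≅ V → Closure H L U → Closure H L V
  resp L = resp-≅ (L ↓[ H ])

  -- Steps never refer to the starting language, so a derivation over `L` becomes one over `M` by
  -- grafting derivations onto its `base` leaves.
  Closure-bind : (L : Language A ℓ₁) (M : Language A ℓ₂) →
                 Contains L ⊆ Closure H M → Closure H L ⊆ Closure H M
  Closure-bind L M L⊆M↓ (base p)       = L⊆M↓ p
  Closure-bind L M L⊆M↓ (step r C k p) = step r C (λ q → Closure-bind L M L⊆M↓ (k q)) p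

  -- Common core of the three product inclusions, with `F` multiplication by a fixed factor. `F-ctx`
  -- says that applying `F` after plugging into `C` amounts to plugging into some context `D`, so a
  -- step in `C` becomes a step in `D`.
  Closure-map : (L : Language A ℓ₁) (M : Language A ℓ₂) (F : LPoset A → LPoset A) →
    (∀ {U V} → U ≅ V → F U ≅ F V) →
    (∀ C → Σ[ D ∈ Context A ] (∀ X → plug D X ≅ F (plug C X))) →
    (∀ {U} → U ∈ L → Closure H M (F U)) →
    ∀ {U} → Closure H L U → Closure H M (F U)
  Closure-map L M F F-cong F-ctx F-base (base p) = F-base p
  Closure-map L M F F-cong F-ctx F-base (step r C k (X , X∈e , i)) =
    step r D
      -- The given pomset is only isomorphic to `plug D Y`, hence to `F (plug C Y)`; the recursion
      -- runs at `plug C Y` and the result is carried back.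
      (λ { (Y , Y∈f , j) → resp M (≅-sym (≅-trans j (D-plug Y)))
             (Closure-map L M F F-cong F-ctx F-base (k (Y , Y∈f , ≅-refl))) })
      (X , X∈e , ≅-trans (F-cong i) (≅-sym (D-plug X)))
    where
    D = proj₁ (F-ctx C)
    D-plug = proj₂ (F-ctx C)

  -- The preorder `_≲_`: monotonicity of the operators and star induction.

  infix 4 _≲_

  _≲_ : Term A → Term A → Set _
  e ≲ f = Contains ⟦ e ⟧ ⊆ Closure H ⟦ f ⟧

  bind : ∀ {e f} → e ≲ f → Closure H ⟦ e ⟧ ⊆ Closure H ⟦ f ⟧
  bind {e} {f} = Closure-bind ⟦ e ⟧ ⟦ f ⟧

  ≲-trans : ∀ {e f g} → e ≲ f → f ≲ g → e ≲ g
  ≲-trans {f = f} {g} p q x = bind {f} {g} q (p x)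

  ⊕-lub : ∀ {e f g} → e ≲ g → f ≲ g → e ⊕ f ≲ g
  ⊕-lub p q = [ (λ x → p x) , (λ x → q x) ]′

  ⊕-upperˡ : ∀ {e f} → e ≲ e ⊕ f
  ⊕-upperˡ x = base (inj₁ x)

  ⊕-upperʳ : ∀ {e f} → f ≲ e ⊕ f
  ⊕-upperʳ x = base (inj₂ x)

  -- Membership of `V` in `⟦ f ⟧` is used twice: through `⟦ f ⟧⊆SP` it allows `V` inside a context,
  -- and at the leaves it places the product in `⟦ e · f ⟧`.
  ↓-·ʳ : ∀ e f {U V} → Closure H ⟦ e ⟧ U → V ∈ ⟦ f ⟧ → Closure H ⟦ e · f ⟧ (U ·ᴾ V)
  ↓-·ʳ e f {V = V} p q = Closure-map ⟦ e ⟧ ⟦ e · f ⟧ (_·ᴾ V) (·ᴾ-congʳ V)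
    (λ C → C ·ᶜʳ ⟦ f ⟧⊆SP q , plug-·ᶜʳ C (⟦ f ⟧⊆SP q))
    (λ p′ → base (_ , _ , p′ , q , ≅-refl)) p

  ↓-·ˡ : ∀ e f {U V} → U ∈ ⟦ e ⟧ → Closure H ⟦ f ⟧ V → Closure H ⟦ e · f ⟧ (U ·ᴾ V)
  ↓-·ˡ e f {U = U} p q = Closure-map ⟦ f ⟧ ⟦ e · f ⟧ (U ·ᴾ_) (·ᴾ-congˡ U)
    (λ C → C ·ᶜˡ ⟦ e ⟧⊆SP p , plug-·ᶜˡ C (⟦ e ⟧⊆SP p))
    (λ q′ → base (_ , _ , p , q′ , ≅-refl)) q

  ↓-∥ : ∀ e f {U V} → Closure H ⟦ e ⟧ U → V ∈ ⟦ f ⟧ → Closure H ⟦ e ∥ f ⟧ (U ∥ᴾ V)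
  ↓-∥ e f {V = V} p q = Closure-map ⟦ e ⟧ ⟦ e ∥ f ⟧ (_∥ᴾ V) (∥ᴾ-congʳ V)
    (λ C → C ∥ᶜ ⟦ f ⟧⊆SP q , plug-∥ᶜ C (⟦ f ⟧⊆SP q))
    (λ p′ → base (_ , _ , p′ , q , ≅-refl)) p

  ·-monoˡ : ∀ {e e′} f → e ≲ e′ → e · f ≲ e′ · f
  ·-monoˡ {e} {e′} f p (_ , _ , x , y , i) = resp ⟦ e′ · f ⟧ (≅-sym i) (↓-·ʳ e′ f (p x) y)

  ·-monoʳ : ∀ e {f f′} → f ≲ f′ → e · f ≲ e · f′
  ·-monoʳ e {f} {f′} p (_ , _ , x , y , i) = resp ⟦ e · f′ ⟧ (≅-sym i) (↓-·ˡ e f′ x (p y))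

  ∥-swap : ∀ e f → e ∥ f ≲ f ∥ e
  ∥-swap e f (X , Y , x , y , i) = base (Y , X , y , x , ≅-trans i (∥ᴾ-comm X Y))

  ∥-monoˡ : ∀ {e e′} f → e ≲ e′ → e ∥ f ≲ e′ ∥ f
  ∥-monoˡ {e} {e′} f p (_ , _ , x , y , i) = resp ⟦ e′ ∥ f ⟧ (≅-sym i) (↓-∥ e′ f (p x) y)

  -- The factors are replaced one after the other, since `↓-·ʳ` and `↓-·ˡ` each want one factor in
  -- the semantics of a term; `≲-trans` absorbs the closure reached in between.
  ·-mono : ∀ {e e′ f f′} → e ≲ e′ → f ≲ f′ → e · f ≲ e′ · f′
  ·-mono {e} {e′} {f} {f′} p q =
    ≲-trans {e · f} {e′ · f} {e′ · f′} (·-monoˡ {e} {e′} f p) (·-monoʳ e′ {f} {f′} q)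

  -- Only the left factor is replaced directly; the right one is swapped to the left, replaced there
  -- and swapped back.
  ∥-mono : ∀ {e e′ f f′} → e ≲ e′ → f ≲ f′ → e ∥ f ≲ e′ ∥ f′
  ∥-mono {e} {e′} {f} {f′} p q =
    ≲-trans {e ∥ f} {e′ ∥ f} {e′ ∥ f′} (∥-monoˡ {e} {e′} f p)
    (≲-trans {e′ ∥ f} {f ∥ e′} {e′ ∥ f′} (∥-swap e′ f)
    (≲-trans {f ∥ e′} {f′ ∥ e′} {e′ ∥ f′} (∥-monoˡ {f} {f′} e′ q) (∥-swap f′ e′)))

  *-inductionˡ : ∀ {e f g} → e ≲ g → f · g ≲ g → f * · e ≲ g
  *-inductionˡ {e} {f} {g} e≲g fg≲g (_ , V , (n , p) , q , i) =
    resp ⟦ g ⟧ (≅-sym i) (go n p)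
    where
    go : ∀ n {U} → U ∈ ⟦ f ⟧ ^ᴸ n → Closure H ⟦ g ⟧ (U ·ᴾ V)
    go zero (lift j) =
      resp ⟦ g ⟧ (≅-sym (≅-trans (·ᴾ-congʳ V j) (·ᴾ-identityˡ V))) (e≲g q)
    go (suc n) (X , Y , x , y , j) =
      resp ⟦ g ⟧ (≅-sym (≅-trans (·ᴾ-congʳ V j) (·ᴾ-assoc X Y V)))
        -- The recursive call puts `Y ·ᴾ V` in the closure of `⟦ g ⟧`; prefixing `X` lands in the
        -- closure of `⟦ f · g ⟧`, which `fg≲g` brings back.
        (bind {f · g} {g} fg≲g (↓-·ˡ f g x (go n y)))

  *-inductionʳ : ∀ {e f g} → e ≲ f → f · g ≲ f → e · g * ≲ f
  *-inductionʳ {e} {f} {g} e≲f fg≲f (_ , _ , p , (n , q) , i) =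
    resp ⟦ f ⟧ (≅-sym i) (go n (e≲f p) q)
    where
    -- Powers expose their leftmost factor, so `U` acts as an accumulator that absorbs the factors
    -- from the right. After the first absorption it is known only to lie in the closure, hence the
    -- generalised assumption on `U`.
    go : ∀ n {U V} → Closure H ⟦ f ⟧ U → V ∈ ⟦ g ⟧ ^ᴸ n → Closure H ⟦ f ⟧ (U ·ᴾ V)
    go zero {U} u (lift j) =
      resp ⟦ f ⟧ (≅-sym (≅-trans (·ᴾ-congˡ U j) (·ᴾ-identityʳ U))) u
    go (suc n) {U} u (X , Y , x , y , j) =
      resp ⟦ f ⟧ (≅-trans (·ᴾ-assoc U X Y) (·ᴾ-congˡ U (≅-sym j)))
        (go n (bind {f · g} {f} fg≲f (↓-·ʳ f g u x)) y)

  ·-identityʳ-≲ : ∀ e → e ≲ e · 𝟏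
  ·-identityʳ-≲ e x = base (_ , _ , x , lift ≅-refl , ≅-sym (·ᴾ-identityʳ _))

  *-nil : ∀ e → 𝟏 ≲ e *
  *-nil e x = base (0 , x)

  *-cons : ∀ e → e · e * ≲ e *
  *-cons e (_ , _ , x , (n , y) , i) = base (suc n , _ , _ , x , y , i)

  -- An instance of left induction with seed `𝟏`: the term `f *` bounds `𝟏`, and it absorbs `e` on
  -- the left because it absorbs `f`.
  *-mono : ∀ {e f} → e ≲ f → e * ≲ f *
  *-mono {e} {f} p = ≲-trans {e *} {e * · 𝟏} {f *} (·-identityʳ-≲ (e *))
    (*-inductionˡ {𝟏} {e} {f *} (*-nil f)
      (≲-trans {e · f *} {f · f *} {f *} (·-monoˡ {e} {f} (f *) p) (*-cons f)))

  *-unfoldʳ-≲ : ∀ e → e * ≲ 𝟏 ⊕ (e * · e)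
  *-unfoldʳ-≲ e (n , p) = base (go n p)
    where
    go : ∀ n {U} → U ∈ ⟦ e ⟧ ^ᴸ n → U ∈ ⟦ 𝟏 ⊕ (e * · e) ⟧
    go zero p = inj₁ p
    go (suc n) (X , Y , x , y , i) with go n y
    -- Powers grow on the left, whereas a last factor is wanted. If the tail is empty, `X` is that
    -- factor, preceded by `1ᴾ`; otherwise the last factor `W` of the tail is kept and `X` joins the
    -- front, making its length `suc m`.
    ... | inj₁ (lift j) =
      inj₂ (1ᴾ , X , (0 , lift ≅-refl) , x ,
        ≅-trans i (≅-trans (·ᴾ-congˡ X j)
          (≅-trans (·ᴾ-identityʳ X) (≅-sym (·ᴾ-identityˡ X)))))
    ... | inj₂ (Z , W , (m , z) , w , j) =
      inj₂ (X ·ᴾ Z , W , (suc m , X , Z , x , z , ≅-refl) , w ,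
        ≅-trans i (≅-trans (·ᴾ-congˡ X j) (≅-sym (·ᴾ-assoc X Z W))))

  -- Left induction with seed `e`, which lies below `e *` as its first power.
  *-snoc : ∀ e → e * · e ≲ e *
  *-snoc e = *-inductionˡ {e} {e} {e *}
    (λ x → base (1 , _ , _ , x , lift ≅-refl , ≅-sym (·ᴾ-identityʳ _))) (*-cons e)

  -- Soundness of the rules, by induction on derivations.

  sound : ∀ {e f} → H ⊢ e ≡ᴴ f → e ≲ f × f ≲ e
  sound (hyp {e} {f} r) =
    ⊕-lub {e} {f} {f}
      -- A hypothesis is a single closure step in the trivial context; its premise holds since
      -- plugging into `∙ᶜ` returns a pomset already in `⟦ f ⟧`.
      (λ {U} p → step r ∙ᶜ
        (λ { (X , x , i) → base (resp-≅ ⟦ f ⟧ (≅-sym (≅-trans i (plug-∙ᶜ X))) x) })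
        (U , p , ≅-sym (plug-∙ᶜ U)))
      base
    , ⊕-upperʳ {e} {f}
  sound reflᴴ = base , base
  -- Symmetry is why both inclusions are carried through the induction.
  sound (symᴴ p) = swap (sound p)
  sound (transᴴ {e} {f} {g} p q) =
    ≲-trans {e} {f} {g} (proj₁ (sound p)) (proj₁ (sound q)) ,
    ≲-trans {g} {f} {e} (proj₂ (sound q)) (proj₂ (sound p))
  sound (⊕-cong {e} {e′} {f} {f′} p q) =
    mono {e} {e′} {f} {f′} (proj₁ (sound p)) (proj₁ (sound q)) ,
    mono {e′} {e} {f′} {f} (proj₂ (sound p)) (proj₂ (sound q))
    where
    mono : ∀ {e e′ f f′} → e ≲ e′ → f ≲ f′ → e ⊕ f ≲ e′ ⊕ f′
    mono {e} {e′} {f} {f′} p q = ⊕-lub {e} {f} {e′ ⊕ f′}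
      (≲-trans {e} {e′} {e′ ⊕ f′} p (⊕-upperˡ {e′} {f′}))
      (≲-trans {f} {f′} {e′ ⊕ f′} q (⊕-upperʳ {e′} {f′}))
  sound (·-cong {e} {e′} {f} {f′} p q) =
    ·-mono {e} {e′} {f} {f′} (proj₁ (sound p)) (proj₁ (sound q)) ,
    ·-mono {e′} {e} {f′} {f} (proj₂ (sound p)) (proj₂ (sound q))
  sound (∥-cong {e} {e′} {f} {f′} p q) =
    ∥-mono {e} {e′} {f} {f′} (proj₁ (sound p)) (proj₁ (sound q)) ,
    ∥-mono {e′} {e} {f′} {f} (proj₂ (sound p)) (proj₂ (sound q))
  sound (*-cong {e} {f} p) =
    *-mono {e} {f} (proj₁ (sound p)) , *-mono {f} {e} (proj₂ (sound p))
  sound (⊕-identʳ e) = (λ { (inj₁ x) → base x }) , ⊕-upperˡ {e} {𝟎}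
  sound (⊕-idem e) = ⊕-lub {e} {e} {e} base base , ⊕-upperˡ {e} {e}
  sound (⊕-comm e f) = (λ x → base (Sum.swap x)) , (λ x → base (Sum.swap x))
  sound (⊕-assoc e f g) = (λ x → base (Sum.assocˡ x)) , (λ x → base (Sum.assocʳ x))
  sound (·-assoc e f g) =
    (λ { (X , _ , x , (Y , Z , y , z , j) , i) → base
         (X ·ᴾ Y , Z , (X , Y , x , y , ≅-refl) , z ,
          ≅-trans i (≅-trans (·ᴾ-congˡ X j) (≅-sym (·ᴾ-assoc X Y Z)))) }) ,
    (λ { (_ , Z , (X , Y , x , y , j) , z , i) → base
         (X , Y ·ᴾ Z , x , (Y , Z , y , z , ≅-refl) ,
          ≅-trans i (≅-trans (·ᴾ-congʳ Z j) (·ᴾ-assoc X Y Z))) })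
  sound (·-distˡ e f g) =
    (λ { (_ , _ , x , inj₁ y , i) → base (inj₁ (_ , _ , x , y , i))
       ; (_ , _ , x , inj₂ y , i) → base (inj₂ (_ , _ , x , y , i)) }) ,
    (λ { (inj₁ (_ , _ , x , y , i)) → base (_ , _ , x , inj₁ y , i)
       ; (inj₂ (_ , _ , x , y , i)) → base (_ , _ , x , inj₂ y , i) })
  sound (·-distʳ e f g) =
    (λ { (_ , _ , inj₁ x , y , i) → base (inj₁ (_ , _ , x , y , i))
       ; (_ , _ , inj₂ x , y , i) → base (inj₂ (_ , _ , x , y , i)) }) ,
    (λ { (inj₁ (_ , _ , x , y , i)) → base (_ , _ , inj₁ x , y , i)
       ; (inj₂ (_ , _ , x , y , i)) → base (_ , _ , inj₂ x , y , i) })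
  sound (·-identʳ e) =
    (λ { (X , _ , x , lift j , i) → base (resp-≅ ⟦ e ⟧
         (≅-sym (≅-trans i (≅-trans (·ᴾ-congˡ X j) (·ᴾ-identityʳ X)))) x) }) ,
    ·-identityʳ-≲ e
  sound (·-identˡ e) =
    (λ x → base (_ , _ , lift ≅-refl , x , ≅-sym (·ᴾ-identityˡ _))) ,
    (λ { (_ , X , lift j , x , i) → base (resp-≅ ⟦ e ⟧
         (≅-sym (≅-trans i (≅-trans (·ᴾ-congʳ X j) (·ᴾ-identityˡ X)))) x) })
  sound (·-zeroʳ e) = (λ { (_ , _ , _ , () , _) }) , (λ ())
  sound (·-zeroˡ e) = (λ ()) , (λ { (_ , _ , () , _ , _) })
  sound (∥-comm e f) = ∥-swap e f , ∥-swap f e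
  sound (∥-identʳ e) =
    (λ { (X , _ , x , lift j , i) → base (resp-≅ ⟦ e ⟧
         (≅-sym (≅-trans i (≅-trans (∥ᴾ-congˡ X j) (∥ᴾ-identityʳ X)))) x) }) ,
    (λ x → base (_ , _ , x , lift ≅-refl , ≅-sym (∥ᴾ-identityʳ _)))
  sound (∥-zeroʳ e) = (λ { (_ , _ , _ , () , _) }) , (λ ())
  sound (∥-assoc e f g) =
    (λ { (X , _ , x , (Y , Z , y , z , j) , i) → base
         (X ∥ᴾ Y , Z , (X , Y , x , y , ≅-refl) , z ,
          ≅-trans i (≅-trans (∥ᴾ-congˡ X j) (≅-sym (∥ᴾ-assoc X Y Z)))) }) ,
    (λ { (_ , Z , (X , Y , x , y , j) , z , i) → base
         (X , Y ∥ᴾ Z , x , (Y , Z , y , z , ≅-refl) ,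
          ≅-trans i (≅-trans (∥ᴾ-congʳ Z j) (∥ᴾ-assoc X Y Z))) })
  sound (∥-distˡ e f g) =
    (λ { (_ , _ , x , inj₁ y , i) → base (inj₁ (_ , _ , x , y , i))
       ; (_ , _ , x , inj₂ y , i) → base (inj₂ (_ , _ , x , y , i)) }) ,
    (λ { (inj₁ (_ , _ , x , y , i)) → base (_ , _ , x , inj₁ y , i)
       ; (inj₂ (_ , _ , x , y , i)) → base (_ , _ , x , inj₂ y , i) })
  sound (*-unfoldˡ e) =
    ⊕-lub {𝟏} {e · e *} {e *} (*-nil e) (*-cons e) ,
    (λ { (zero , x) → base (inj₁ x)
       ; (suc n , _ , _ , x , y , i) → base (inj₂ (_ , _ , x , (n , y) , i)) })
  sound (*-unfoldʳ e) =
    *-unfoldʳ-≲ e , ⊕-lub {𝟏} {e * · e} {e *} (*-nil e) (*-snoc e)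
  sound (*-leastˡ {e} {f} {g} p) =
    ⊕-lub {f * · e} {g} {g}
      -- The premise abbreviates an equation with left side `(e ⊕ f · g) ⊕ g`; restricting its first
      -- inclusion to the two inner summands gives the seed and the absorption condition.
      (*-inductionˡ {e} {f} {g} (λ x → q (inj₁ (inj₁ x))) (λ x → q (inj₁ (inj₂ x)))) base ,
    ⊕-upperʳ {f * · e} {g}
    where q = proj₁ (sound p)
  sound (*-leastʳ {e} {f} {g} p) =
    ⊕-lub {e · g *} {f} {f}
      (*-inductionʳ {e} {f} {g} (λ x → q (inj₁ (inj₁ x))) (λ x → q (inj₁ (inj₂ x)))) base ,
    ⊕-upperʳ {e · g *} {f}
    where q = proj₁ (sound p)

lemma4p7 : {a h : Level} {A : Set a} (H : Hypotheses A h) (e f : Term A) →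
    H ⊢ e ≡ᴴ f → ⟦ e ⟧ ↓[ H ] ≈ᴸ ⟦ f ⟧ ↓[ H ]
-- `sound` bounds only the languages of the terms; `bind` extends each bound to their closures.
lemma4p7 H e f p = bind H {e} {f} (proj₁ (sound H p)) , bind H {f} {e} (proj₂ (sound H p))
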